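{- The worst-case approximation ratio of greedy-weight for $\mathrm{MFD}_{\mathbb N}$ is $\Omega(m/\log m)$ on sparse graphs. That is, there exist constants $c, C>0$ and an infinite family of instances $(G,X)$, where $G=(V,E)$ is an $s$-$t$ DAG with $m=|E|\le C\,|V|$ and $m$ unbounded over the family, and $X\colon E\to\mathbb N$ is a flow, such that on each instance of the family the number of paths used by greedy-weight to decompose $X$ is at least $c\cdot\frac{m}{\log m}\cdot \mathrm{mfd}_{\mathbb N}(G,X)$.
   Context: An $s$-$t$ DAG is a directed acyclic graph $G=(V,E)$ with a unique source $s$ (no in-edges) and a unique sink $t$ (no out-edges). A flow is a function $X$ on $E$ such that at every node of $V\setminus\{s,t\}$ incoming flow equals outgoing flow. An $s$-$t$ path $P$ is identified with the flow that is $1$ on the edges of $P$ and $0$ elsewhere. A flow decomposition of $(G,X)$ of size $k$ with weights in $\mathbb N$ ($0\in\mathbb N$) is a family of $s$-$t$ paths $P_1,\dots,P_k$ with weights $w_1,\dots,w_k\in\mathbb N$ such that $X=w_1P_1+\dots+w_kP_k$; $\mathrm{mfd}_{\mathbb N}(G,X)$ is the smallest size of such a decomposition, and $\mathrm{MFD}_{\mathbb N}$ is the problem of finding one of smallest size. A path $P$ carries flow $p$ if $X(e)\ge p$ for every edge $e$ of $P$. Greedy-weight is the algorithm that, starting from $X$, repeatedly picks a heaviest path, i.e. an $s$-$t$ path carrying the largest possible flow $p$ in the current remaining flow (ties broken arbitrarily), adds it to the decomposition with weight $p$, and subtracts $p$ from the remaining flow on each of its edges, until the remaining flow is $0$. 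-}

module Defs where

open import Data.Bool.Base using (if_then_else_)
open import Data.Fin.Base using (Fin)
open import Data.Fin.Properties using (_≟_)
open import Data.Integer.Base using (+_)
open import Data.List.Base using (List; []; _∷_; map; filter; allFin; length)
open import Data.List.Membership.Propositional using (_∈_)
import Data.List.Membership.DecPropositional as DecMembership
open import Data.Nat.Base
  using (ℕ; zero; suc; _*_; _∸_; _≤_; NonZero; NonTrivial; >-nonZero; nonTrivial⇒n>1)
open import Data.Nat.ListAction using (sum)
open import Data.Nat.Logarithm using (⌊log₂_⌋; ⌊log₂⌋-mono-≤)
open import Data.Product.Base using (_×_; _,_; Σ-syntax)
open import Data.Rational.Base using (ℚ; _/_)
open import Relation.Binary.PropositionalEquality.Core using (_≡_; _≢_)
open import Relation.Nullary using (¬_; does)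

-- Finite simple directed graphs: `simple` excludes parallel edges.

record Digraph : Set where
  field
    ∣V∣ ∣E∣ : ℕ

  V : Set
  V = Fin ∣V∣

  E : Set
  E = Fin ∣E∣

  field
    src tgt : E → V
    simple  : ∀ e f → src e ≡ src f → tgt e ≡ tgt f → e ≡ f

  -- Directed walks; in an acyclic graph these are exactly the directed paths.

  infixr 5 _∷⟨_⟩_

  data Path : V → V → Set where
    []      : ∀ {v} → Path v v
    _∷⟨_⟩_ : ∀ {u v} (e : E) → src e ≡ u → Path (tgt e) v → Path u v

  edges : ∀ {u v} → Path u v → List E
  edges []             = []
  edges (e ∷⟨ _ ⟩ p) = e ∷ edges p

  Acyclic : Set
  Acyclic = ∀ e → ¬ Path (tgt e) (src e)

  IsSource IsSink : V → Set
  IsSource v = ∀ e → tgt e ≢ v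
  IsSink   v = ∀ e → src e ≢ v

record STDAG : Set where
  field
    digraph : Digraph

  open Digraph digraph public

  field
    acyclic  : Acyclic
    s t      : V
    s-source : IsSource s
    s-unique : ∀ v → IsSource v → v ≡ s
    t-sink   : IsSink t
    t-unique : ∀ v → IsSink v → v ≡ t

module Flows (G : STDAG) where
  open STDAG G
  open DecMembership {A = E} _≟_ using (_∈?_)

  STPath : Set
  STPath = Path s t

  inflow outflow : (E → ℕ) → V → ℕ
  inflow  X v = sum (map X (filter (λ e → tgt e ≟ v) (allFin ∣E∣)))
  outflow X v = sum (map X (filter (λ e → src e ≟ v) (allFin ∣E∣)))

  IsFlow : (E → ℕ) → Set
  IsFlow X = ∀ v → v ≢ s → v ≢ t → inflow X v ≡ outflow X v

  IsZero : (E → ℕ) → Set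
  IsZero X = ∀ e → X e ≡ 0

  ⟦_⟧ : STPath → E → ℕ
  ⟦ P ⟧ e = if does (e ∈? edges P) then 1 else 0

  WeightedPaths : Set
  WeightedPaths = List (STPath × ℕ)

  IsDecomposition : (E → ℕ) → WeightedPaths → Set
  IsDecomposition X D = ∀ e → X e ≡ sum (map (λ (P , w) → w * ⟦ P ⟧ e) D)

  IsMFD : (E → ℕ) → ℕ → Set
  IsMFD X k =
    (Σ[ D ∈ WeightedPaths ] IsDecomposition X D × length D ≡ k) ×
    (∀ D → IsDecomposition X D → k ≤ length D)

  Carries : (E → ℕ) → STPath → ℕ → Set
  Carries X P p = ∀ e → e ∈ edges P → p ≤ X e

  Heaviest : (E → ℕ) → STPath → ℕ → Set
  Heaviest X P p = Carries X P p × (∀ Q q → Carries X Q q → q ≤ p)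

  -- `GreedyWeight X D`: some run of the algorithm on X, with ties broken in
  -- some way, outputs D. The truncated subtraction is exact, since P carries p.

  data GreedyWeight : (E → ℕ) → WeightedPaths → Set where
    stop : ∀ {X} → IsZero X → GreedyWeight X []
    pick : ∀ {X D} P p → ¬ IsZero X → Heaviest X P p →
           GreedyWeight (λ e → X e ∸ p * ⟦ P ⟧ e) D →
           GreedyWeight X ((P , p) ∷ D)

-- The zero flow is excluded, so that the minimum size of a decomposition is
-- positive and approximation ratios make sense.

record Instance : Set where
  field
    G : STDAG

  open STDAG G public
  open Flows G public

  field
    X         : E → ℕ
    X-flow    : IsFlow X
    X-nonzero : ¬ IsZero X

-- m / log m for m ≥ 2. Replacing the logarithm by ⌊log₂ m⌋ changes the value
-- by at most a constant factor, and only upwards compared to m / log₂ m.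

⌊log₂⌋-nonZero : ∀ m .{{_ : NonTrivial m}} → NonZero ⌊log₂ m ⌋
⌊log₂⌋-nonZero m = >-nonZero (⌊log₂⌋-mono-≤ (nonTrivial⇒n>1 m))

_/log : ∀ m → .{{_ : NonTrivial m}} → ℚ
m /log = (+ m / ⌊log₂ m ⌋) {{⌊log₂⌋-nonZero m}}

fromℕ : ℕ → ℚ
fromℕ n = + n / 1

-- On a path of 2·2ᵈ vertices (the spine), whose edges are alternately leaves
-- and links, put an out-tree of jumps from s to the tails of the 2ᵈ leaves and
-- the mirrored in-tree of jumps from their heads to t. Let 2ᵈ units flow along
-- the spine and one further unit through each leaf, distributed by the
-- out-tree and collected by the in-tree. The only heaviest path is the spine.
-- Once greedy-weight has removed it the links are dead, so every later path
-- serves at most one of the 2ᵈ leaves, each of which still carries a unit.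
-- In contrast, the out-jumps that span 2ʲ leaves have pairwise disjoint spans,
-- so a single path of weight 2ʲ, which travels along the spine between them,
-- covers them all, and likewise for the in-jumps: 2d paths and the spine with
-- weight 2 suffice, while there are 4·2ᵈ − 3 edges.
module Submission where

open import Defs

module DyadicFlows where

  open import Data.Bool.Base using (true; false; if_then_else_)
  open import Data.Fin.Base as Fin using (Fin; zero; suc; punchIn; combine; remQuot)
  open import Data.Fin.Patterns using (0F; 1F)
  open import Data.Fin.Properties
    using (_≟_; any?; punchIn-injective; punchInᵢ≢i;
           toℕ-combine; combine-monoˡ-<; combine-remQuot; remQuot-combine)
  import Data.Integer.Base as ℤ
  import Data.Integer.Properties as ℤ
  open import Data.List.Base using (List; []; _∷_; map; filter; allFin; tabulate; length)
  open import Data.List.Membership.Propositional using (_∈_; _∉_)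
  import Data.List.Membership.DecPropositional as DecMembership
  open import Data.List.Properties using (length-map; map-cong; map-tabulate)
  open import Data.List.Relation.Unary.Any using (here; there)
  open import Data.Nat.Base hiding (_/_)
  open import Data.Nat.ListAction using (sum)
  open import Data.Nat.Logarithm using (⌊log₂_⌋; ⌊log₂⌋-mono-≤; ⌊log₂[2^n]⌋≡n)
  open import Data.Nat.Properties as ℕ
    using (+-assoc; +-comm; +-identityʳ; *-identityʳ; *-zeroʳ; *-distribˡ-+; *-distribʳ-+)
  open import Algebra.Properties.CommutativeSemigroup ℕ.+-commutativeSemigroup using (interchange)
  open import Data.Nat.Solver using (module +-*-Solver)
  open import Data.Product.Base using (_×_; _,_; ∃-syntax; proj₁; proj₂; map₁)
  open import Data.Rational.Base as ℚ using (_/_; toℚᵘ)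
  import Data.Rational.Properties as ℚ
  open import Data.Rational.Properties using (toℚᵘ-fromℚᵘ; toℚᵘ-homo-*; toℚᵘ-cancel-≤; toℚᵘ-injective)
  open import Data.Rational.Unnormalised.Base as ℚᵘ using (mkℚᵘ; *≤*)
  import Data.Rational.Unnormalised.Properties as ℚᵘ
  open import Data.Sum.Base using (_⊎_; inj₁; inj₂)
  open import Data.Vec.Base using (Vec; []; _∷_; replicate; lookup)
  open import Data.Vec.Properties using (∷-injective)
  open import Function.Base using (_∘_; id)
  open import Function.Bundles using (mk⇔)
  open import Relation.Binary.PropositionalEquality
  open import Relation.Nullary using (¬_; Dec; does; yes; no; contradiction)
  open import Relation.Nullary.Decidable using (dec-true; dec-false; does-⇔)
  open import Relation.Unary using (Pred; Decidable)

  -- Sums of indicators over filtered lists.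

  𝟙 : ∀ {p} {P : Set p} → Dec P → ℕ
  𝟙 p? = if does p? then 1 else 0

  module _ {a} {A : Set a} where
    open ≡-Reasoning

    sum-map-0 : ∀ (xs : List A) → sum (map (λ _ → 0) xs) ≡ 0
    sum-map-0 []       = refl
    sum-map-0 (_ ∷ xs) = sum-map-0 xs

    sum-map-+ : ∀ (f g : A → ℕ) xs →
                sum (map (λ x → f x + g x) xs) ≡ sum (map f xs) + sum (map g xs)
    sum-map-+ f g []       = refl
    sum-map-+ f g (x ∷ xs) = begin
      f x + g x + sum (map (λ x → f x + g x) xs)    ≡⟨ cong (f x + g x +_) (sum-map-+ f g xs) ⟩
      f x + g x + (sum (map f xs) + sum (map g xs)) ≡⟨ interchange (f x) (g x) _ _ ⟩
      f x + sum (map f xs) + (g x + sum (map g xs)) ∎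

    sum-map-* : ∀ c (f : A → ℕ) xs → sum (map (λ x → c * f x) xs) ≡ c * sum (map f xs)
    sum-map-* c f []       = sym (*-zeroʳ c)
    sum-map-* c f (x ∷ xs) = trans (cong (c * f x +_) (sum-map-* c f xs)) (sym (*-distribˡ-+ c _ _))

  sum-tabulate-0 : ∀ n → sum (tabulate {n = n} (λ _ → 0)) ≡ 0
  sum-tabulate-0 zero    = refl
  sum-tabulate-0 (suc n) = sum-tabulate-0 n

  sum-tabulate-𝟙 : ∀ {n} (i : Fin n) → sum (tabulate (λ j → 𝟙 (j ≟ i))) ≡ 1
  sum-tabulate-𝟙 {suc n} zero    = cong suc (sum-tabulate-0 n)
  sum-tabulate-𝟙 {suc n} (suc i) = sum-tabulate-𝟙 i

  module _ {n p} {Q : Pred (Fin n) p} (Q? : Decidable Q) (i : Fin n) where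
    open ≡-Reasoning

    sum-filter-𝟙 : ∀ xs → sum (map (λ j → 𝟙 (j ≟ i)) (filter Q? xs))
                        ≡ 𝟙 (Q? i) * sum (map (λ j → 𝟙 (j ≟ i)) xs)
    sum-filter-𝟙 []       = sym (*-zeroʳ (𝟙 (Q? i)))
    sum-filter-𝟙 (x ∷ xs) with does (Q? x) in eq
    sum-filter-𝟙 (x ∷ xs) | true with x ≟ i
    ... | yes refl rewrite eq = cong suc (trans (sum-filter-𝟙 xs) (cong (λ b → (if b then 1 else 0) * _) eq))
    ... | no  _    = sum-filter-𝟙 xs
    sum-filter-𝟙 (x ∷ xs) | false with x ≟ i
    ... | yes refl rewrite eq = trans (sum-filter-𝟙 xs) (cong (λ b → (if b then 1 else 0) * _) eq)
    ... | no  _    = sum-filter-𝟙 xs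

    sum-filter-allFin-𝟙 : sum (map (λ j → 𝟙 (j ≟ i)) (filter Q? (allFin n))) ≡ 𝟙 (Q? i)
    sum-filter-allFin-𝟙 = begin
      sum (map (λ j → 𝟙 (j ≟ i)) (filter Q? (allFin n)))    ≡⟨ sum-filter-𝟙 (allFin n) ⟩
      𝟙 (Q? i) * sum (map (λ j → 𝟙 (j ≟ i)) (allFin n))     ≡⟨ cong (λ xs → 𝟙 (Q? i) * sum xs)
                                                                    (map-tabulate {n = n} id (λ j → 𝟙 (j ≟ i))) ⟩
      𝟙 (Q? i) * sum (tabulate (λ j → 𝟙 (j ≟ i)))           ≡⟨ cong (𝟙 (Q? i) *_) (sum-tabulate-𝟙 i) ⟩
      𝟙 (Q? i) * 1                                          ≡⟨ *-identityʳ _ ⟩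
      𝟙 (Q? i)                                              ∎

  -- Flow conservation for weighted sums of paths.

  module Conservation (G : STDAG) where
    open STDAG G
    open Flows G
    open DecMembership {A = E} _≟_ using (_∈?_)
    open ≡-Reasoning

    into outOf : V → List E
    into  v = filter (λ e → tgt e ≟ v) (allFin ∣E∣)
    outOf v = filter (λ e → src e ≟ v) (allFin ∣E∣)

    -- Counting with multiplicity is additive along a path, which permits induction; by acyclicity
    -- it agrees with the membership indicator in `⟦_⟧`.
    mult : ∀ {u v} → Path u v → E → ℕ
    mult []             e = 0
    mult (f ∷⟨ _ ⟩ P) e = 𝟙 (e ≟ f) + mult P e

    mult-∉ : ∀ {u v} (P : Path u v) {e} → e ∉ edges P → mult P e ≡ 0
    mult-∉ []                 e∉ = refl
    mult-∉ (f ∷⟨ _ ⟩ P) {e} e∉ rewrite dec-false (e ≟ f) (e∉ ∘ here) = mult-∉ P (e∉ ∘ there)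

    prefix : ∀ {u v} (P : Path u v) {e} → e ∈ edges P → Path u (src e)
    prefix (f ∷⟨ refl ⟩ P) (here refl) = []
    prefix (f ∷⟨ eq ⟩ P)   (there e∈)  = f ∷⟨ eq ⟩ prefix P e∈

    -- A repeated edge would close a cycle.
    𝟙-∈≡mult : ∀ {u v} (P : Path u v) e → 𝟙 (e ∈? edges P) ≡ mult P e
    𝟙-∈≡mult []             e = refl
    𝟙-∈≡mult (f ∷⟨ _ ⟩ P) e with e ≟ f
    ... | yes refl = cong suc (sym (mult-∉ P (acyclic e ∘ prefix P)))
    ... | no  _    = 𝟙-∈≡mult P e

    -- The two endpoint indicators make the balance hold at every vertex without subtraction, hence
    -- also for the intermediate paths of the induction.
    mult-conservation : ∀ {u w} (P : Path u w) v →
                        inflow (mult P) v + 𝟙 (u ≟ v) ≡ outflow (mult P) v + 𝟙 (w ≟ v)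
    mult-conservation {u} [] v =
      cong (_+ 𝟙 (u ≟ v)) (trans (sum-map-0 (into v)) (sym (sum-map-0 (outOf v))))
    mult-conservation {w = w} (f ∷⟨ refl ⟩ P) v = begin
      inflow (mult (f ∷⟨ refl ⟩ P)) v + 𝟙 (src f ≟ v)
        ≡⟨ cong (_+ 𝟙 (src f ≟ v)) (sum-map-+ _ (mult P) (into v)) ⟩
      sum (map (λ e → 𝟙 (e ≟ f)) (into v)) + inflow (mult P) v + 𝟙 (src f ≟ v)
        ≡⟨ cong (λ x → x + inflow (mult P) v + 𝟙 (src f ≟ v)) (sum-filter-allFin-𝟙 (λ e → tgt e ≟ v) f) ⟩
      𝟙 (tgt f ≟ v) + inflow (mult P) v + 𝟙 (src f ≟ v)
        ≡⟨ cong (_+ 𝟙 (src f ≟ v)) (trans (+-comm (𝟙 (tgt f ≟ v)) _) (mult-conservation P v)) ⟩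
      outflow (mult P) v + 𝟙 (w ≟ v) + 𝟙 (src f ≟ v)
        ≡⟨ trans (+-comm _ (𝟙 (src f ≟ v))) (sym (+-assoc (𝟙 (src f ≟ v)) _ _)) ⟩
      𝟙 (src f ≟ v) + outflow (mult P) v + 𝟙 (w ≟ v)
        ≡⟨ cong (λ x → x + outflow (mult P) v + 𝟙 (w ≟ v)) (sum-filter-allFin-𝟙 (λ e → src e ≟ v) f) ⟨
      sum (map (λ e → 𝟙 (e ≟ f)) (outOf v)) + outflow (mult P) v + 𝟙 (w ≟ v)
        ≡⟨ cong (_+ 𝟙 (w ≟ v)) (sum-map-+ _ (mult P) (outOf v)) ⟨
      outflow (mult (f ∷⟨ refl ⟩ P)) v + 𝟙 (w ≟ v) ∎

    STPath-flow : ∀ (P : STPath) → IsFlow ⟦ P ⟧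
    STPath-flow P v v≢s v≢t = begin
      inflow ⟦ P ⟧ v                    ≡⟨ cong sum (map-cong (𝟙-∈≡mult P) (into v)) ⟩
      inflow (mult P) v                 ≡⟨ +-identityʳ _ ⟨
      inflow (mult P) v + 0             ≡⟨ cong (λ b → inflow (mult P) v + (if b then 1 else 0))
                                                (dec-false (s ≟ v) (v≢s ∘ sym)) ⟨
      inflow (mult P) v + 𝟙 (s ≟ v)     ≡⟨ mult-conservation P v ⟩
      outflow (mult P) v + 𝟙 (t ≟ v)    ≡⟨ cong (λ b → outflow (mult P) v + (if b then 1 else 0))
                                                (dec-false (t ≟ v) (v≢t ∘ sym)) ⟩
      outflow (mult P) v + 0            ≡⟨ +-identityʳ _ ⟩
      outflow (mult P) v                ≡⟨ cong sum (map-cong (𝟙-∈≡mult P) (outOf v)) ⟨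
      outflow ⟦ P ⟧ v                   ∎

    superposition : WeightedPaths → E → ℕ
    superposition D e = sum (map (λ (P , w) → w * ⟦ P ⟧ e) D)

    superposition-flow : ∀ D → IsFlow (superposition D)
    superposition-flow [] v _ _ =
      trans (sum-map-0 (into v)) (sym (sum-map-0 (outOf v)))
    superposition-flow ((P , w) ∷ D) v v≢s v≢t = begin
      inflow (superposition ((P , w) ∷ D)) v
        ≡⟨ split (into v) ⟩
      w * inflow ⟦ P ⟧ v + inflow (superposition D) v
        ≡⟨ cong₂ (λ x y → w * x + y) (STPath-flow P v v≢s v≢t) (superposition-flow D v v≢s v≢t) ⟩
      w * outflow ⟦ P ⟧ v + outflow (superposition D) v
        ≡⟨ split (outOf v) ⟨
      outflow (superposition ((P , w) ∷ D)) v ∎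
      where
      split : ∀ es → sum (map (superposition ((P , w) ∷ D)) es)
                   ≡ w * sum (map ⟦ P ⟧ es) + sum (map (superposition D) es)
      split es = trans (sum-map-+ _ (superposition D) es) (cong (_+ _) (sum-map-* w ⟦ P ⟧ es))

    -- Conservation is linear, so exhibiting a decomposition of `X` spares a vertex-by-vertex check
    -- of its flow property.
    decomposition⇒flow : ∀ {X} D → IsDecomposition X D → IsFlow X
    decomposition⇒flow D X≗D v v≢s v≢t = begin
      inflow _ v                    ≡⟨ cong sum (map-cong X≗D (into v)) ⟩
      inflow (superposition D) v    ≡⟨ superposition-flow D v v≢s v≢t ⟩
      outflow (superposition D) v   ≡⟨ cong sum (map-cong X≗D (outOf v)) ⟨
      outflow _ v                   ∎

  -- Paths in deterministic edge sets, and a cut crossed at most once.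

  module _ (D : Digraph) where
    open Digraph D

    -- Two paths inside `C` cannot diverge, since a tail determines the edge; and neither can stop
    -- while the other continues, since `v` is a sink.
    deterministic-path-unique : (C : E → Set) → (∀ {e f} → C e → C f → src e ≡ src f → e ≡ f) →
                  ∀ {u v} → IsSink v → (P Q : Path u v) →
                  (∀ e → e ∈ edges P → C e) → (∀ e → e ∈ edges Q → C e) →
                  edges P ≡ edges Q
    deterministic-path-unique C det sink []             []              _  _  = refl
    deterministic-path-unique C det sink []             (f ∷⟨ eq ⟩ _)  _  _  = contradiction eq (sink f)
    deterministic-path-unique C det sink (e ∷⟨ eq ⟩ _) []              _  _  = contradiction eq (sink e)
    deterministic-path-unique C det sink (e ∷⟨ p ⟩ P)  (f ∷⟨ q ⟩ Q)   CP CQ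
      with refl ← det (CP e (here refl)) (CQ f (here refl)) (trans p (sym q))
      = cong (e ∷_) (deterministic-path-unique C det sink P Q (λ g → CP g ∘ there) (λ g → CQ g ∘ there))

  -- `Late` marks the vertices behind the cut formed by the leaves.
  module LeafCut (G : STDAG)
    (Leaf Link : STDAG.E G → Set) (Late : STDAG.V G → Set)
    (leaf⇒late  : ∀ e → Leaf e → Late (STDAG.tgt G e))
    (late-stays : ∀ e → ¬ Link e → Late (STDAG.src G e) → Late (STDAG.tgt G e))
    (late⇒¬leaf : ∀ e → ¬ Link e → Late (STDAG.src G e) → ¬ Leaf e)
    where
    open STDAG G
    open Flows G
    open DecMembership {A = E} _≟_ using (_∈?_)

    Linkless : ∀ {u v} → Path u v → Set
    Linkless P = ∀ {e} → e ∈ edges P → ¬ Link e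

    late-leafless : ∀ {u v} (P : Path u v) → Linkless P → Late u → ∀ {e} → e ∈ edges P → ¬ Leaf e
    late-leafless (e ∷⟨ refl ⟩ P) nl l (here refl) = late⇒¬leaf e (nl (here refl)) l
    late-leafless (e ∷⟨ refl ⟩ P) nl l (there e∈)  =
      late-leafless P (nl ∘ there) (late-stays e (nl (here refl)) l) e∈

    -- The first leaf on the path leads behind the cut, and without links nothing leads back, so no
    -- second leaf can follow.
    leaf-unique : ∀ {u v} (P : Path u v) → Linkless P → ∀ {e f} →
                  e ∈ edges P → f ∈ edges P → Leaf e → Leaf f → e ≡ f
    leaf-unique (_ ∷⟨ _ ⟩ P) nl (here refl) (here refl) le lf = refl
    leaf-unique (e ∷⟨ _ ⟩ P) nl (here refl) (there f∈)  le lf =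
      contradiction lf (late-leafless P (nl ∘ there) (leaf⇒late e le) f∈)
    leaf-unique (f ∷⟨ _ ⟩ P) nl (there e∈)  (here refl) le lf =
      contradiction le (late-leafless P (nl ∘ there) (leaf⇒late f lf) e∈)
    leaf-unique (_ ∷⟨ _ ⟩ P) nl (there e∈)  (there f∈)  le lf = leaf-unique P (nl ∘ there) e∈ f∈ le lf

    subtract-0 : ∀ (Y : E → ℕ) P p {e} → Y e ≡ 0 → Y e ∸ p * ⟦ P ⟧ e ≡ 0
    subtract-0 Y P p {e} Ye≡0 = trans (cong (_∸ p * ⟦ P ⟧ e) Ye≡0) (ℕ.0∸n≡0 (p * ⟦ P ⟧ e))

    subtract-∉ : ∀ (Y : E → ℕ) P p {e} → e ∉ edges P → 0 < Y e → 0 < Y e ∸ p * ⟦ P ⟧ e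
    subtract-∉ Y P p {e} e∉ Ye>0 rewrite dec-false (e ∈? edges P) e∉ | *-zeroʳ p = Ye>0

    -- Induction on the run. A path of positive weight avoids the empty links, so it meets at most
    -- one of the `k` leaves; the others keep their flow.
    leaves≤length : ∀ {Y D} → GreedyWeight Y D → (∀ {e} → Link e → Y e ≡ 0) →
                    ∀ k (a : Fin k → E) → (∀ {i j} → a i ≡ a j → i ≡ j) →
                    (∀ i → Leaf (a i)) → (∀ i → 0 < Y (a i)) → k ≤ length D
    leaves≤length _ _ zero _ _ _ _ = z≤n
    leaves≤length (stop Y≡0) _ (suc k) a _ _ Y>0 = contradiction (Y≡0 (a zero)) (ℕ.>⇒≢ (Y>0 zero))
    -- The type of `pick` admits weight 0. Such a path might use links, but it leaves `Y`
    -- definitionally unchanged.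
    leaves≤length (pick P zero _ _ run) Y≡0 k@(suc _) a inj leaf Y>0 =
      ℕ.m≤n⇒m≤1+n (leaves≤length run Y≡0 k a inj leaf Y>0)
    leaves≤length {Y} (pick P p@(suc _) _ (carries , _) run) Y≡0 (suc k) a inj leaf Y>0
      with any? (λ i → a i ∈? edges P)
    -- `punchIn i` drops the leaf served by `P`; `leaf-unique` keeps `P` off all the others.
    ... | yes (i , ai∈P) = s≤s (leaves≤length run (λ l → subtract-0 Y P p (Y≡0 l)) k (a ∘ punchIn i)
            (punchIn-injective i _ _ ∘ inj) (leaf ∘ punchIn i) (λ j → subtract-∉ Y P p
              (λ aj∈P → punchInᵢ≢i i j (inj (leaf-unique P linkless aj∈P ai∈P (leaf _) (leaf _))))
              (Y>0 (punchIn i j))))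
      where
      linkless : Linkless P
      linkless e∈ l = ℕ.<⇒≱ (s≤s z≤n) (ℕ.≤-trans (carries _ e∈) (ℕ.≤-reflexive (Y≡0 l)))
    ... | no ∄ = ℕ.m≤n⇒m≤1+n (leaves≤length run (λ l → subtract-0 Y P p (Y≡0 l)) (suc k) a inj leaf
            (λ j → subtract-∉ Y P p (λ aj∈P → ∄ (j , aj∈P)) (Y>0 j)))

  -- Bit strings and their codes.

  private variable
    n d : ℕ

  Bits : ℕ → Set
  Bits = Vec (Fin 2)

  -- The leading bit is the most significant one, so the code of a vertex is its position on the
  -- spine.
  code : Bits n → Fin (2 ^ n)
  code []      = 0F
  code (b ∷ x) = combine b (code x)

  decode : Fin (2 ^ n) → Bits n
  decode {zero}  _ = []
  decode {suc n} i = proj₁ (remQuot {2} (2 ^ n) i) ∷ decode (proj₂ (remQuot {2} (2 ^ n) i))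

  code-decode : ∀ (i : Fin (2 ^ n)) → code (decode {n} i) ≡ i
  code-decode {zero}  0F = refl
  code-decode {suc n} i  = trans
    (cong (combine (proj₁ (remQuot {2} (2 ^ n) i))) (code-decode {n} (proj₂ (remQuot {2} (2 ^ n) i))))
    (combine-remQuot {2} (2 ^ n) i)

  decode-code : ∀ (x : Bits n) → decode (code x) ≡ x
  decode-code []      = refl
  decode-code (b ∷ x) =
    trans (cong (λ (c , i) → c ∷ decode i) (remQuot-combine b (code x))) (cong (b ∷_) (decode-code x))

  code-injective : ∀ {x y : Bits n} → code x ≡ code y → x ≡ y
  code-injective {x = x} {y} eq = trans (sym (decode-code x)) (trans (cong decode eq) (decode-code y))

  decode-injective : ∀ {i j : Fin (2 ^ n)} → decode {n} i ≡ decode {n} j → i ≡ j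
  decode-injective {n} {i} {j} eq = trans (sym (code-decode {n} i)) (trans (cong code eq) (code-decode {n} j))

  code-monoʳ-< : ∀ b (x y : Bits n) → code x Fin.< code y → code (b ∷ x) Fin.< code (b ∷ y)
  code-monoʳ-< {n} b x y x<y
    rewrite toℕ-combine b (code x) | toℕ-combine b (code y) = ℕ.+-monoʳ-< (2 ^ n * Fin.toℕ b) x<y

  -- The recursive graph: edges, kinds and incidence.

  -- The first `d` bits address a leaf, the last bit selects its tail (0) or its head (1).
  Vertex : ℕ → Set
  Vertex d = Bits (suc d)

  first last : Vertex d
  first = replicate _ 0F
  last  = replicate _ 1F

  -- `over` edges form the out-tree, `under` edges the in-tree.
  data Edge : ℕ → Set where
    leaf            : Edge 0
    half            : Fin 2 → Edge d → Edge (suc d)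
    link over under : Edge (suc d)

  -- Each level joins the roots of two copies of a tree, the first vertices by `over` and the last
  -- ones by `under`; so both trees are binomial trees.
  source target : Edge d → Vertex d
  source leaf       = 0F ∷ []
  source (half b e) = b ∷ source e
  source link       = 0F ∷ last
  source over       = 0F ∷ first
  source under      = 0F ∷ last
  target leaf       = 1F ∷ []
  target (half b e) = b ∷ target e
  target link       = 1F ∷ first
  target over       = 1F ∷ first
  target under      = 1F ∷ last

  -- The kind alone determines the flow on an edge. The jumps of kind `jump j` pass between two
  -- adjacent blocks of `2 ^ j` leaves each.
  data Kind : Set where
    leaf link : Kind
    jump      : ℕ → Kind

  kind : Edge d → Kind
  kind             leaf       = leaf
  kind             (half _ e) = kind e
  kind             link       = link
  kind {d = suc d} over       = jump d
  kind {d = suc d} under      = jump d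

  -- These are the values of the flow. An out-jump of kind `jump j` feeds the `2 ^ j` leaves of the
  -- block it enters; an in-jump collects from those of the block it leaves.
  capacity : ℕ → Kind → ℕ
  capacity d leaf     = suc (2 ^ d)
  capacity d link     = 2 ^ d
  capacity d (jump j) = 2 ^ j

  onSpine : Kind → ℕ
  onSpine leaf     = 1
  onSpine link     = 1
  onSpine (jump _) = 0

  size : ℕ → ℕ
  size zero    = 1
  size (suc d) = 3 + 2 * size d

  index : Edge d → Fin (size d)
  index leaf       = 0F
  index link       = 0F
  index over       = 1F
  index under      = suc 1F
  index (half b e) = suc (suc (suc (combine b (index e))))

  edge : Fin (size d) → Edge d
  edge {zero}  _                   = leaf
  edge {suc d} zero                = link
  edge {suc d} (suc zero)          = over
  edge {suc d} (suc (suc zero))    = under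
  edge {suc d} (suc (suc (suc i))) =
    half (proj₁ (remQuot {2} (size d) i)) (edge (proj₂ (remQuot {2} (size d) i)))

  edge-index : ∀ (e : Edge d) → edge (index e) ≡ e
  edge-index leaf       = refl
  edge-index link       = refl
  edge-index over       = refl
  edge-index under      = refl
  edge-index (half b e) =
    trans (cong (λ (c , i) → half c (edge i)) (remQuot-combine b (index e))) (cong (half b) (edge-index e))

  index-edge : ∀ (i : Fin (size d)) → index (edge {d} i) ≡ i
  index-edge {zero}  zero                = refl
  index-edge {suc d} zero                = refl
  index-edge {suc d} (suc zero)          = refl
  index-edge {suc d} (suc (suc zero))    = refl
  index-edge {suc d} (suc (suc (suc i))) = cong (λ j → suc (suc (suc j)))
    (trans (cong (combine (proj₁ (remQuot {2} (size d) i))) (index-edge {d} (proj₂ (remQuot {2} (size d) i))))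
           (combine-remQuot {2} (size d) i))

  index-injective : ∀ {e f : Edge d} → index e ≡ index f → e ≡ f
  index-injective {e = e} {f} eq = trans (sym (edge-index e)) (trans (cong edge eq) (edge-index f))

  edge-injective : ∀ {i j : Fin (size d)} → edge {d} i ≡ edge {d} j → i ≡ j
  edge-injective {d} {i} {j} eq = trans (sym (index-edge {d} i)) (trans (cong index eq) (index-edge {d} j))

  source≢last : ∀ (e : Edge d) → source e ≢ last
  source≢last leaf        ()
  source≢last (half 1F e) eq = source≢last e (proj₂ (∷-injective eq))
  source≢last (half 0F e) ()
  source≢last link        ()
  source≢last over        ()
  source≢last under       ()

  target≢first : ∀ (e : Edge d) → target e ≢ first
  target≢first leaf        ()
  target≢first (half 0F e) eq = target≢first e (proj₂ (∷-injective eq))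
  target≢first (half 1F e) ()
  target≢first link        ()
  target≢first over        ()
  target≢first under       ()

  -- Within its half, only the first vertex lacks an in-edge; in the right half the link supplies
  -- one. This yields the uniqueness of the source.
  first-or-target : ∀ (x : Vertex d) → x ≡ first ⊎ ∃[ e ] target e ≡ x
  first-or-target (0F ∷ []) = inj₁ refl
  first-or-target (1F ∷ []) = inj₂ (leaf , refl)
  first-or-target {suc d} (b ∷ x) with first-or-target x
  ... | inj₂ (e , refl) = inj₂ (half b e , refl)
  first-or-target {suc d} (0F ∷ x) | inj₁ refl = inj₁ refl
  first-or-target {suc d} (1F ∷ x) | inj₁ refl = inj₂ (link , refl)

  last-or-source : ∀ (x : Vertex d) → x ≡ last ⊎ ∃[ e ] source e ≡ x
  last-or-source (1F ∷ []) = inj₁ refl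
  last-or-source (0F ∷ []) = inj₂ (leaf , refl)
  last-or-source {suc d} (b ∷ x) with last-or-source x
  ... | inj₂ (e , refl) = inj₂ (half b e , refl)
  last-or-source {suc d} (1F ∷ x) | inj₁ refl = inj₁ refl
  last-or-source {suc d} (0F ∷ x) | inj₁ refl = inj₂ (link , refl)

  -- An edge inside a half keeps the leading bit, whereas links and jumps of the current level raise
  -- it from 0 to 1.
  half-not-crossing : ∀ {b} {x x′ y y′ : Bits n} → b ∷ x ≡ 0F ∷ x′ → b ∷ y ≢ 1F ∷ y′
  half-not-crossing refl ()

  endpoints-injective : ∀ (e f : Edge d) → source e ≡ source f → target e ≡ target f → e ≡ f
  endpoints-injective leaf       leaf       _ _ = refl
  endpoints-injective (half b e) (half c f) p q with refl , p′ ← ∷-injective p =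
    cong (half b) (endpoints-injective e f p′ (proj₂ (∷-injective q)))
  endpoints-injective (half b e) link       p q = contradiction q (half-not-crossing p)
  endpoints-injective (half b e) over       p q = contradiction q (half-not-crossing p)
  endpoints-injective (half b e) under      p q = contradiction q (half-not-crossing p)
  endpoints-injective link       (half c f) p q = contradiction (sym q) (half-not-crossing (sym p))
  endpoints-injective over       (half c f) p q = contradiction (sym q) (half-not-crossing (sym p))
  endpoints-injective under      (half c f) p q = contradiction (sym q) (half-not-crossing (sym p))
  endpoints-injective link       link       _ _ = refl
  endpoints-injective link       over       () _
  endpoints-injective link       under      _ ()
  endpoints-injective over       link       () _
  endpoints-injective over       over       _ _ = refl
  endpoints-injective over       under      () _
  endpoints-injective under      link       _ ()
  endpoints-injective under      over       () _
  endpoints-injective under      under      _ _ = refl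

  -- Codes are thus a topological order, which gives acyclicity.
  source<target : ∀ (e : Edge d) → code (source e) Fin.< code (target e)
  source<target leaf          = s≤s z≤n
  source<target (half b e)    = code-monoʳ-< b (source e) (target e) (source<target e)
  source<target {suc d} link  = combine-monoˡ-< {2} {i = 0F} {1F} (code (last {d})) (code (first {d})) (s≤s z≤n)
  source<target {suc d} over  = combine-monoˡ-< {2} {i = 0F} {1F} (code (first {d})) (code (first {d})) (s≤s z≤n)
  source<target {suc d} under = combine-monoˡ-< {2} {i = 0F} {1F} (code (last {d})) (code (last {d})) (s≤s z≤n)

  jump< : ∀ (e : Edge d) {j} → kind e ≡ jump j → j < d
  jump< (half b e)   eq   = ℕ.m<n⇒m<1+n (jump< e eq)
  jump< over         refl = ℕ.≤-refl
  jump< under        refl = ℕ.≤-refl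

  -- A link starts at the last vertex of the left half, which no edge inside that half leaves.
  spine-deterministic : ∀ (e f : Edge d) → onSpine (kind e) ≡ 1 → onSpine (kind f) ≡ 1 →
                        source e ≡ source f → e ≡ f
  spine-deterministic leaf       leaf       _ _ _ = refl
  spine-deterministic (half b e) (half c f) p q eq with refl , eq′ ← ∷-injective eq =
    cong (half b) (spine-deterministic e f p q eq′)
  spine-deterministic (half b e) link       _ _ eq = contradiction (proj₂ (∷-injective eq)) (source≢last e)
  spine-deterministic link       (half c f) _ _ eq = contradiction (sym (proj₂ (∷-injective eq))) (source≢last f)
  spine-deterministic link       link       _ _ _ = refl

  -- Heads of leaves are the vertices with last bit 1.
  Late : Vertex d → Set
  Late {d} x = lookup x (Fin.fromℕ d) ≡ 1F

  leaf⇒late : ∀ (e : Edge d) → kind e ≡ leaf → Late (target e)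
  leaf⇒late leaf       _ = refl
  leaf⇒late (half b e) k = leaf⇒late e k

  -- A jump flips only the leading bit of its block, never the last bit, on which `Late` depends.
  late-stays : ∀ (e : Edge d) → kind e ≢ link → Late (source e) → Late (target e)
  late-stays leaf            _ ()
  late-stays (half b e)      k l = late-stays e k l
  late-stays link            k _ = contradiction refl k
  late-stays {suc d} over    _ l = l
  late-stays {suc d} under   _ l = l

  late⇒≢leaf : ∀ (e : Edge d) → Late (source e) → kind e ≢ leaf
  late⇒≢leaf (half b e) l k = late⇒≢leaf e l k

  leafAt : Bits d → Edge d
  leafAt []      = leaf
  leafAt (b ∷ x) = half b (leafAt x)

  leafAt-kind : ∀ (x : Bits d) → kind (leafAt x) ≡ leaf
  leafAt-kind []      = refl
  leafAt-kind (b ∷ x) = leafAt-kind x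

  leafAt-injective : ∀ {x y : Bits d} → leafAt x ≡ leafAt y → x ≡ y
  leafAt-injective {x = x} {y} eq = trans (sym (address-leafAt x)) (trans (cong address eq) (address-leafAt y))
    where
    address : Edge d → Bits d
    address leaf       = []
    address (half b e) = b ∷ address e
    -- A default for edges that are not leaves, never reached from `leafAt`.
    address _          = replicate _ 0F
    address-leafAt : ∀ (x : Bits d) → address (leafAt x) ≡ x
    address-leafAt []      = refl
    address-leafAt (b ∷ x) = cong (b ∷_) (address-leafAt x)

  -- Walks in the recursive graph and their edge counts.

  infixr 5 _∷_ _++_

  -- Over the inductive edges, with bit strings as endpoints, so that walks can be built by
  -- recursion on halves; `toPath` later translates them to `Path`.
  data Walk {d} : Vertex d → Vertex d → Set where
    []  : ∀ {x} → Walk x x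
    _∷_ : ∀ {y} (e : Edge d) → Walk (target e) y → Walk (source e) y

  _++_ : ∀ {x y z : Vertex d} → Walk x y → Walk y z → Walk x z
  []      ++ W′ = W′
  (e ∷ W) ++ W′ = e ∷ (W ++ W′)

  inHalf : ∀ b {x y : Vertex d} → Walk x y → Walk (b ∷ x) (b ∷ y)
  inHalf b []      = []
  inHalf b (e ∷ W) = half b e ∷ inHalf b W

  infix 4 _≟ᵉ_

  -- Comparing indices makes `occ` match `mult` term by term and lets comparisons of distinct
  -- constructors compute.
  _≟ᵉ_ : ∀ (e f : Edge d) → Dec (index e ≡ index f)
  e ≟ᵉ f = index e ≟ index f

  occ : ∀ {x y : Vertex d} → Walk x y → Edge d → ℕ
  occ []      e = 0
  occ (f ∷ W) e = 𝟙 (e ≟ᵉ f) + occ W e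

  occ-++ : ∀ {x y z : Vertex d} (W : Walk x y) (W′ : Walk y z) e → occ (W ++ W′) e ≡ occ W e + occ W′ e
  occ-++ []      W′ e = refl
  occ-++ (f ∷ W) W′ e = trans (cong (𝟙 (e ≟ᵉ f) +_) (occ-++ W W′ e)) (sym (+-assoc (𝟙 (e ≟ᵉ f)) _ _))

  half-injective : ∀ {b c} {e f : Edge d} → half b e ≡ half c f → b ≡ c × e ≡ f
  half-injective refl = refl , refl

  occ-inHalf : ∀ b {x y : Vertex d} (W : Walk x y) e → occ (inHalf b W) (half b e) ≡ occ W e
  occ-inHalf b []      e = refl
  occ-inHalf b (f ∷ W) e = cong₂ _+_
    (cong (λ t → if t then 1 else 0)
      (does-⇔ (mk⇔ (cong index ∘ proj₂ ∘ half-injective ∘ index-injective {e = half b e} {half b f})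
                   (cong (λ f → index (half b f)) ∘ index-injective {e = e} {f}))
              (half b e ≟ᵉ half b f) (e ≟ᵉ f)))
    (occ-inHalf b W e)

  occ-inHalf-≢ : ∀ {b c} → b ≢ c → ∀ {x y : Vertex d} (W : Walk x y) e → occ (inHalf b W) (half c e) ≡ 0
  occ-inHalf-≢ b≢c []      e = refl
  occ-inHalf-≢ {b = b} {c} b≢c (f ∷ W) e
    rewrite dec-false (half c e ≟ᵉ half b f) (b≢c ∘ sym ∘ proj₁ ∘ half-injective ∘ index-injective) =
    occ-inHalf-≢ b≢c W e

  occ-inHalf-link : ∀ b {x y : Vertex d} (W : Walk x y) → occ (inHalf b W) link ≡ 0
  occ-inHalf-link b []      = refl
  occ-inHalf-link b (f ∷ W) = occ-inHalf-link b W

  occ-inHalf-over : ∀ b {x y : Vertex d} (W : Walk x y) → occ (inHalf b W) over ≡ 0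
  occ-inHalf-over b []      = refl
  occ-inHalf-over b (f ∷ W) = occ-inHalf-over b W

  occ-inHalf-under : ∀ b {x y : Vertex d} (W : Walk x y) → occ (inHalf b W) under ≡ 0
  occ-inHalf-under b []      = refl
  occ-inHalf-under b (f ∷ W) = occ-inHalf-under b W

  -- Repeating `W` in both halves loads both copies at the price of one path; hence only two new
  -- paths are needed per level.
  join : Walk {d} first last → Walk {suc d} first last
  join W = inHalf 0F W ++ link ∷ inHalf 1F W

  occ-join-half : ∀ b (W : Walk {d} first last) e → occ (join W) (half b e) ≡ occ W e
  occ-join-half 0F W e = begin
    occ (join W) (half 0F e)                                      ≡⟨ occ-++ (inHalf 0F W) _ (half 0F e) ⟩
    occ (inHalf 0F W) (half 0F e) + occ (inHalf 1F W) (half 0F e) ≡⟨ cong₂ _+_ (occ-inHalf 0F W e)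
                                                                             (occ-inHalf-≢ (λ ()) W e) ⟩
    occ W e + 0                                                   ≡⟨ +-identityʳ _ ⟩
    occ W e                                                       ∎
    where open ≡-Reasoning
  occ-join-half 1F W e = begin
    occ (join W) (half 1F e)                                      ≡⟨ occ-++ (inHalf 0F W) _ (half 1F e) ⟩
    occ (inHalf 0F W) (half 1F e) + occ (inHalf 1F W) (half 1F e) ≡⟨ cong₂ _+_ (occ-inHalf-≢ (λ ()) W e)
                                                                             (occ-inHalf 1F W e) ⟩
    occ W e                                                       ∎
    where open ≡-Reasoning

  occ-join-link : ∀ (W : Walk {d} first last) → occ (join W) link ≡ 1
  occ-join-link W = trans (occ-++ (inHalf 0F W) _ link)
    (cong₂ (λ m n → m + (1 + n)) (occ-inHalf-link 0F W) (occ-inHalf-link 1F W))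

  occ-join-over : ∀ (W : Walk {d} first last) → occ (join W) over ≡ 0
  occ-join-over W = trans (occ-++ (inHalf 0F W) _ over)
    (cong₂ _+_ (occ-inHalf-over 0F W) (occ-inHalf-over 1F W))

  occ-join-under : ∀ (W : Walk {d} first last) → occ (join W) under ≡ 0
  occ-join-under W = trans (occ-++ (inHalf 0F W) _ under)
    (cong₂ _+_ (occ-inHalf-under 0F W) (occ-inHalf-under 1F W))

  spine : ∀ d → Walk {d} first last
  spine zero    = leaf ∷ []
  spine (suc d) = join (spine d)

  occ-spine : ∀ d (e : Edge d) → occ (spine d) e ≡ onSpine (kind e)
  occ-spine zero    leaf       = refl
  occ-spine (suc d) (half b e) = trans (occ-join-half b (spine d) e) (occ-spine d e)
  occ-spine (suc d) link       = occ-join-link (spine d)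
  occ-spine (suc d) over       = occ-join-over (spine d)
  occ-spine (suc d) under      = occ-join-under (spine d)

  -- Each takes one top-level jump and the spine of one half: the right half for `overWalk`, the
  -- left for `underWalk`. Together they load the spine of each half once.
  overWalk underWalk : ∀ d → Walk {suc d} first last
  overWalk  d = over ∷ inHalf 1F (spine d)
  underWalk d = inHalf 0F (spine d) ++ under ∷ []

  occ-underWalk : ∀ d e → occ (underWalk d) e ≡ occ (inHalf 0F (spine d)) e + (𝟙 (e ≟ᵉ under) + 0)
  occ-underWalk d = occ-++ (inHalf 0F (spine d)) (under ∷ [])

  -- The decomposition into `1 + d + d` walks.

  WeightedWalks : ℕ → Set
  WeightedWalks d = List (Walk {d} first last × ℕ)

  load : WeightedWalks d → Edge d → ℕ
  load Ws e = sum (map (λ (W , w) → w * occ W e) Ws)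

  -- For the three edges outside the halves: `n` is 1 for the link, which every joined walk crosses
  -- once, and 0 for the two jumps.
  load-join : ∀ (Ws : WeightedWalks d) e n → (∀ W → occ (join W) e ≡ n) →
              load (map (map₁ join) Ws) e ≡ sum (map proj₂ Ws) * n
  load-join []             e n eq = refl
  load-join ((W , w) ∷ Ws) e n eq = trans
    (cong₂ (λ m l → w * m + l) (eq W) (load-join Ws e n eq))
    (sym (*-distribʳ-+ n w _))

  load-join-half : ∀ (Ws : WeightedWalks d) b e → load (map (map₁ join) Ws) (half b e) ≡ load Ws e
  load-join-half []             b e = refl
  load-join-half ((W , w) ∷ Ws) b e =
    cong₂ (λ m l → w * m + l) (occ-join-half b W e) (load-join-half Ws b e)

  -- Through repeated `join`, the two walks of weight `2 ^ j` come to traverse all out-jumps and all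
  -- in-jumps of kind `jump j`, respectively.
  walks : ∀ d → WeightedWalks d
  walks zero    = (spine 0 , 2) ∷ []
  walks (suc d) = (overWalk d , 2 ^ d) ∷ (underWalk d , 2 ^ d) ∷ map (map₁ join) (walks d)

  length-walks : ∀ d → length (walks d) ≡ 1 + d + d
  length-walks zero    = refl
  length-walks (suc d) = cong (2 +_) (begin
    length (map (map₁ join) (walks d))  ≡⟨ length-map _ (walks d) ⟩
    length (walks d)                    ≡⟨ length-walks d ⟩
    1 + d + d                           ≡⟨ ℕ.+-suc d d ⟨
    d + suc d                           ∎)
    where open ≡-Reasoning

  weights-join : ∀ (Ws : WeightedWalks d) → sum (map proj₂ (map (map₁ join) Ws)) ≡ sum (map proj₂ Ws)
  weights-join []             = refl
  weights-join ((_ , w) ∷ Ws) = cong (w +_) (weights-join Ws)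

  -- This total is what the link of the next level receives, since all joined walks cross it.
  weights-walks : ∀ d → sum (map proj₂ (walks d)) ≡ 2 ^ suc d
  weights-walks zero    = refl
  weights-walks (suc d) rewrite weights-join (walks d) | weights-walks d =
    solve 1 (λ n → n :+ (n :+ con 2 :* n) := con 2 :* (con 2 :* n)) refl (2 ^ d)
    where open +-*-Solver

  -- The inductive step inside a half: exactly one of the two new walks follows its spine, adding
  -- `2 ^ d` there and nothing on its jumps.
  capacity-suc : ∀ d k → 2 ^ d * onSpine k + capacity d k ≡ capacity (suc d) k
  capacity-suc d leaf = solve 1 (λ n → n :* con 1 :+ (con 1 :+ n) := con 1 :+ con 2 :* n) refl (2 ^ d)
    where open +-*-Solver
  capacity-suc d link = solve 1 (λ n → n :* con 1 :+ n := con 2 :* n) refl (2 ^ d)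
    where open +-*-Solver
  capacity-suc d (jump j) = cong (_+ 2 ^ j) (*-zeroʳ (2 ^ d))

  load-walks : ∀ d e → load (walks d) e ≡ capacity d (kind e)
  load-walks zero    leaf = refl
  load-walks (suc d) (half 0F e)
    rewrite occ-inHalf-≢ {b = 1F} {0F} (λ ()) (spine d) e | *-zeroʳ (2 ^ d)
          | occ-underWalk d (half 0F e) | occ-inHalf 0F (spine d) e | +-identityʳ (occ (spine d) e)
          | occ-spine d e | load-join-half (walks d) 0F e | load-walks d e = capacity-suc d (kind e)
  load-walks (suc d) (half 1F e)
    rewrite occ-inHalf 1F (spine d) e
          | occ-underWalk d (half 1F e) | occ-inHalf-≢ {b = 0F} {1F} (λ ()) (spine d) e | *-zeroʳ (2 ^ d)
          | occ-spine d e | load-join-half (walks d) 1F e | load-walks d e = capacity-suc d (kind e)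
  load-walks (suc d) link
    rewrite occ-inHalf-link 1F (spine d) | occ-underWalk d link | occ-inHalf-link 0F (spine d)
          | *-zeroʳ (2 ^ d) | load-join (walks d) link 1 occ-join-link | *-identityʳ (sum (map proj₂ (walks d)))
          = weights-walks d
  load-walks (suc d) over
    rewrite occ-inHalf-over 1F (spine d) | occ-underWalk d over | occ-inHalf-over 0F (spine d)
          | *-zeroʳ (2 ^ d) | load-join (walks d) over 0 occ-join-over | *-zeroʳ (sum (map proj₂ (walks d)))
          | *-identityʳ (2 ^ d) = +-identityʳ _
  load-walks (suc d) under
    rewrite occ-inHalf-under 1F (spine d) | occ-underWalk d under | occ-inHalf-under 0F (spine d)
          | *-zeroʳ (2 ^ d) | load-join (walks d) under 0 occ-join-under | *-zeroʳ (sum (map proj₂ (walks d)))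
          | *-identityʳ (2 ^ d) = +-identityʳ _

  -- The graph as an s-t DAG on finite index sets.

  graph : ℕ → STDAG
  graph d = record
    { digraph  = D
    ; acyclic  = λ e P → ℕ.<⇒≱ (source<target (edge {d} e)) (walk-≤ P)
    ; s        = code (first {d})
    ; t        = code (last {d})
    ; s-source = λ e eq → target≢first (edge {d} e) (code-injective eq)
    ; s-unique = s-unique
    ; t-sink   = λ e eq → source≢last (edge {d} e) (code-injective eq)
    ; t-unique = t-unique
    }
    where
    D : Digraph
    D = record
      { ∣V∣    = 2 ^ suc d
      ; ∣E∣    = size d
      ; src    = λ e → code (source (edge {d} e))
      ; tgt    = λ e → code (target (edge {d} e))
      ; simple = λ e f p q → edge-injective {d}
                   (endpoints-injective (edge {d} e) (edge {d} f) (code-injective p) (code-injective q))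
      }
    open Digraph D

    walk-≤ : ∀ {u v} → Path u v → u Fin.≤ v
    walk-≤ []              = ℕ.≤-refl
    walk-≤ (e ∷⟨ refl ⟩ P) = ℕ.≤-trans (ℕ.<⇒≤ (source<target (edge {d} e))) (walk-≤ P)

    s-unique : ∀ v → IsSource v → v ≡ code (first {d})
    s-unique v v-source with first-or-target {d} (decode {suc d} v)
    ... | inj₁ eq       = trans (sym (code-decode {suc d} v)) (cong code eq)
    ... | inj₂ (e , eq) = contradiction
      (trans (cong code (trans (cong target (edge-index e)) eq)) (code-decode {suc d} v))
      (v-source (index e))

    t-unique : ∀ v → IsSink v → v ≡ code (last {d})
    t-unique v v-sink with last-or-source {d} (decode {suc d} v)
    ... | inj₁ eq       = trans (sym (code-decode {suc d} v)) (cong code eq)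
    ... | inj₂ (e , eq) = contradiction
      (trans (cong code (trans (cong source (edge-index e)) eq)) (code-decode {suc d} v))
      (v-sink (index e))

  -- The instance of depth `d` and the runs of greedy-weight on it.

  module Family (d : ℕ) where
    open STDAG (graph d)
    open Flows (graph d)
    open Conservation (graph d)
    open DecMembership {A = E} _≟_ using (_∈?_)

    arc : E → Edge d
    arc = edge

    kindOf : E → Kind
    kindOf e = kind (arc e)

    X : E → ℕ
    X e = capacity d (kindOf e)

    -- Endpoints are matched up to propositional equality, because `edge (index e)` does not reduce
    -- to `e`.
    step : ∀ {u v w} (e : E) → src e ≡ u → tgt e ≡ w → Path w v → Path u v
    step e p refl P = e ∷⟨ p ⟩ P

    mult-step : ∀ {u v w} f (p : src f ≡ u) (q : tgt f ≡ w) (P : Path w v) e →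
                mult (step f p q P) e ≡ 𝟙 (e ≟ f) + mult P e
    mult-step f p refl P e = refl

    toPath : ∀ {x y} → Walk {d} x y → Path (code x) (code y)
    toPath []      = []
    toPath (e ∷ W) =
      step (index e) (cong (code ∘ source) (edge-index e)) (cong (code ∘ target) (edge-index e)) (toPath W)

    mult-toPath : ∀ {x y} (W : Walk {d} x y) e → mult (toPath W) (index e) ≡ occ W e
    mult-toPath []      e = refl
    mult-toPath (f ∷ W) e = trans
      (mult-step (index f) _ (cong (code ∘ target) (edge-index f)) (toPath W) (index e))
      (cong (𝟙 (index e ≟ index f) +_) (mult-toPath W e))

    ⟦toPath⟧ : ∀ (W : Walk {d} first last) e → ⟦ toPath W ⟧ e ≡ occ W (arc e)
    ⟦toPath⟧ W e = trans (𝟙-∈≡mult (toPath W) e)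
      (trans (cong (mult (toPath W)) (sym (index-edge {d} e))) (mult-toPath W (arc e)))

    paths : WeightedWalks d → WeightedPaths
    paths = map (map₁ toPath)

    superposition-paths : ∀ Ws e → superposition (paths Ws) e ≡ load Ws (arc e)
    superposition-paths []             e = refl
    superposition-paths ((W , w) ∷ Ws) e =
      cong₂ (λ m l → w * m + l) (⟦toPath⟧ W e) (superposition-paths Ws e)

    decomposition : WeightedPaths
    decomposition = paths (walks d)

    X-decomposition : IsDecomposition X decomposition
    X-decomposition e = sym (trans (superposition-paths (walks d) e) (load-walks d (arc e)))

    length-decomposition : length decomposition ≡ 1 + d + d
    length-decomposition = trans (length-map _ (walks d)) (length-walks d)

    leafEdge : Fin (2 ^ d) → E
    leafEdge i = index (leafAt (decode {d} i))

    leafEdge-injective : ∀ {i j} → leafEdge i ≡ leafEdge j → i ≡ j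
    leafEdge-injective = decode-injective {d} ∘ leafAt-injective ∘ index-injective

    kind-leafEdge : ∀ i → kindOf (leafEdge i) ≡ leaf
    kind-leafEdge i = trans (cong kind (edge-index (leafAt (decode {d} i)))) (leafAt-kind (decode {d} i))

    X-nonzero : ¬ IsZero X
    X-nonzero X≡0 = ℕ.1+n≢0 (trans (sym (cong (capacity d) (kind-leafEdge i))) (X≡0 (leafEdge i)))
      where
      i : Fin (2 ^ d)
      i = code (replicate d 0F)

    spinePath : STPath
    spinePath = toPath (spine d)

    ⟦spinePath⟧ : ∀ e → ⟦ spinePath ⟧ e ≡ onSpine (kindOf e)
    ⟦spinePath⟧ e = trans (⟦toPath⟧ (spine d) e) (occ-spine d (arc e))

    ∈-spinePath : ∀ e → e ∈ edges spinePath → onSpine (kindOf e) ≡ 1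
    ∈-spinePath e e∈ =
      trans (sym (⟦spinePath⟧ e)) (cong (λ b → if b then 1 else 0) (dec-true (e ∈? edges spinePath) e∈))

    X-spine : ∀ e → onSpine (kindOf e) ≡ 1 → 2 ^ d ≤ X e
    X-spine e eq with kindOf e
    ... | leaf = ℕ.n≤1+n _
    ... | link = ℕ.≤-refl

    -- The threshold `2 ^ d` separates the spine from the jumps, which carry `2 ^ j` with `j < d`.
    spine-X : ∀ e → 2 ^ d ≤ X e → onSpine (kindOf e) ≡ 1
    spine-X e 2^d≤ with kindOf e in eq
    ... | leaf   = refl
    ... | link   = refl
    ... | jump j = contradiction 2^d≤ (ℕ.<⇒≱ (ℕ.^-monoʳ-< 2 (s≤s (s≤s z≤n)) (jump< (arc e) eq)))

    -- The spine carries `2 ^ d`, so a heaviest path carries at least as much. It is then confined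
    -- to spine edges, where determinism leaves only the spine itself.
    heaviest-spine : ∀ {P p} → Heaviest X P p → 2 ^ d ≤ p × edges P ≡ edges spinePath
    heaviest-spine {P} {p} (carries , maximal) = 2^d≤p , deterministic-path-unique digraph
      (λ e → onSpine (kindOf e) ≡ 1)
      (λ {e} {f} p q eq → edge-injective {d} (spine-deterministic (arc e) (arc f) p q (code-injective eq)))
      t-sink P spinePath
      (λ e e∈ → spine-X e (ℕ.≤-trans 2^d≤p (carries e e∈)))
      ∈-spinePath
      where
      2^d≤p : 2 ^ d ≤ p
      2^d≤p = maximal spinePath (2 ^ d) (λ e e∈ → X-spine e (∈-spinePath e e∈))

    IsLeaf IsLink : E → Set
    IsLeaf e = kindOf e ≡ leaf
    IsLink e = kindOf e ≡ link

    LateV : V → Set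
    LateV v = Late {d} (decode {suc d} v)

    fromLate : ∀ x → LateV (code x) → Late {d} x
    fromLate x = subst (Late {d}) (decode-code x)

    toLate : ∀ x → Late {d} x → LateV (code x)
    toLate x = subst (Late {d}) (sym (decode-code x))

    leaf⇒lateV : ∀ e → IsLeaf e → LateV (tgt e)
    leaf⇒lateV e k = toLate (target (arc e)) (leaf⇒late (arc e) k)

    lateV-stays : ∀ e → ¬ IsLink e → LateV (src e) → LateV (tgt e)
    lateV-stays e k l = toLate (target (arc e)) (late-stays (arc e) k (fromLate (source (arc e)) l))

    lateV⇒¬leaf : ∀ e → ¬ IsLink e → LateV (src e) → ¬ IsLeaf e
    lateV⇒¬leaf e _ l = late⇒≢leaf (arc e) (fromLate (source (arc e)) l)

    open LeafCut (graph d) IsLeaf IsLink LateV leaf⇒lateV lateV-stays lateV⇒¬leaf using (leaves≤length)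

    -- The first path is the spine, and the link `l` on it caps its weight at `2 ^ d`. So all links
    -- are emptied while each leaf keeps a unit, and `leaves≤length` applies to the rest of the run.
    greedy-length : ∀ {l} → kindOf l ≡ link → ∀ {D} → GreedyWeight X D → 2 ^ d ≤ length D
    greedy-length _ (stop X≡0) = contradiction X≡0 X-nonzero
    greedy-length {l} l-link (pick P p _ heavy run) = ℕ.m≤n⇒m≤1+n
      (leaves≤length run drained (2 ^ d) leafEdge leafEdge-injective kind-leafEdge left-over)
      where
      ⟦P⟧ : ∀ e → ⟦ P ⟧ e ≡ onSpine (kindOf e)
      ⟦P⟧ e = trans (cong (λ es → 𝟙 (e ∈? es)) (proj₂ (heaviest-spine heavy))) (⟦spinePath⟧ e)

      drained : ∀ {e} → kindOf e ≡ link → X e ∸ p * ⟦ P ⟧ e ≡ 0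
      drained {e} k rewrite ⟦P⟧ e | k | *-identityʳ p = ℕ.m≤n⇒m∸n≡0 (proj₁ (heaviest-spine heavy))

      l∈spinePath : l ∈ edges spinePath
      l∈spinePath with l ∈? edges spinePath | ⟦spinePath⟧ l
      ... | yes l∈ | _  = l∈
      ... | no  _  | eq = contradiction (trans eq (cong onSpine l-link)) λ ()

      p≤2^d : p ≤ 2 ^ d
      p≤2^d = subst (λ k → p ≤ capacity d k) l-link
        (proj₁ heavy l (subst (l ∈_) (sym (proj₂ (heaviest-spine heavy))) l∈spinePath))

      left-over : ∀ i → 0 < X (leafEdge i) ∸ p * ⟦ P ⟧ (leafEdge i)
      left-over i rewrite ⟦P⟧ (leafEdge i) | kind-leafEdge i | *-identityʳ p = ℕ.m<n⇒0<n∸m (s≤s p≤2^d)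

    inst : Instance
    inst = record
      { G         = graph d
      ; X         = X
      ; X-flow    = decomposition⇒flow decomposition X-decomposition
      ; X-nonzero = X-nonzero
      }

  -- Estimates for the number of edges and its logarithm.

  -- Adding 3 turns the recursion `3 + 2 * m` into doubling.
  size+3 : ∀ d → size d + 3 ≡ 2 ^ (2 + d)
  size+3 zero    = refl
  size+3 (suc d) = trans
    (solve 1 (λ m → con 3 :+ con 2 :* m :+ con 3 := con 2 :* (m :+ con 3)) refl (size d))
    (cong (2 *_) (size+3 d))
    where open +-*-Solver

  size-upper : ∀ d → size d ≤ 2 ^ (2 + d)
  size-upper d = ℕ.≤-trans (ℕ.m≤m+n (size d) 3) (ℕ.≤-reflexive (size+3 d))

  size-lower : ∀ d → 2 ^ (2 + d) ≤ size (suc d)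
  size-lower zero    = s≤s (s≤s (s≤s (s≤s z≤n)))
  size-lower (suc d) = ℕ.≤-trans (ℕ.*-monoʳ-≤ 2 (size-lower d)) (ℕ.m≤n+m _ 3)

  n≤size : ∀ d → d ≤ size d
  n≤size zero    = z≤n
  n≤size (suc d) = s≤s (ℕ.≤-trans (n≤size d) (ℕ.≤-trans (ℕ.m≤m+n _ _) (ℕ.m≤n+m _ 2)))

  -- The logarithm stands in the denominator of the ratio, so it has to be bounded from below.
  log-size : ∀ d → 2 + d ≤ ⌊log₂ size (suc d) ⌋
  log-size d = ℕ.≤-trans (ℕ.≤-reflexive (sym (⌊log₂[2^n]⌋≡n (2 + d)))) (⌊log₂⌋-mono-≤ (size-lower d))

  -- The claimed ratio with denominators cleared. The constant 8 is the product of 4, from at most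
  -- `4 * 2 ^ d` edges, and 2, from at most `2 * (1 + d)` paths.
  ratio-bound : ∀ {d k L l} → k ≤ 1 + d + d → 1 + d ≤ L → 2 ^ d ≤ l → size d * k ≤ 8 * L * l
  ratio-bound {d} {k} {L} {l} k≤ L≥ l≥ = begin
    size d * k                      ≤⟨ ℕ.*-mono-≤ (size-upper d) k≤ ⟩
    -- Rounding up to an even number exposes the factor `1 + d`, which `L` bounds.
    2 ^ (2 + d) * (1 + d + d)       ≤⟨ ℕ.*-monoʳ-≤ (2 ^ (2 + d)) (ℕ.n≤1+n _) ⟩
    2 ^ (2 + d) * (2 + d + d)       ≡⟨ solve 2 (λ n d → con 2 :* (con 2 :* n) :* (con 2 :+ d :+ d)
                                                   := con 8 :* (con 1 :+ d) :* n) refl (2 ^ d) d ⟩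
    8 * (1 + d) * 2 ^ d             ≤⟨ ℕ.*-mono-≤ (ℕ.*-monoʳ-≤ 8 L≥) l≥ ⟩
    8 * L * l                       ∎
    where
    open ℕ.≤-Reasoning
    open +-*-Solver

  -- Transfer of the estimates to rational numbers.

  -- Since `_/_` cancels common factors, the comparison passes through unnormalised fractions, where
  -- it is cross-multiplication.
  ≤-fraction : ∀ a b c d .{{_ : NonZero b}} .{{_ : NonZero d}} →
               a * d ≤ c * b → ℤ.+ a / b ℚ.≤ ℤ.+ c / d
  ≤-fraction a (suc b) c (suc d) ad≤cb = toℚᵘ-cancel-≤ (begin
    toℚᵘ (ℤ.+ a / suc b)  ≃⟨ toℚᵘ-fromℚᵘ (mkℚᵘ (ℤ.+ a) b) ⟩
    mkℚᵘ (ℤ.+ a) b        ≤⟨ *≤* (subst₂ ℤ._≤_ (ℤ.pos-* a (suc d)) (ℤ.pos-* c (suc b)) (ℤ.+≤+ ad≤cb)) ⟩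
    mkℚᵘ (ℤ.+ c) d        ≃⟨ toℚᵘ-fromℚᵘ (mkℚᵘ (ℤ.+ c) d) ⟨
    toℚᵘ (ℤ.+ c / suc d)  ∎)
    where open ℚᵘ.≤-Reasoning

  *-fraction : ∀ a b c d .{{_ : NonZero b}} .{{_ : NonZero d}} .{{_ : NonZero (b * d)}} →
               (ℤ.+ a / b) ℚ.* (ℤ.+ c / d) ≡ ℤ.+ (a * c) / (b * d)
  *-fraction a (suc b) c (suc d) = toℚᵘ-injective (begin-equality
    toℚᵘ ((ℤ.+ a / suc b) ℚ.* (ℤ.+ c / suc d))
      ≃⟨ toℚᵘ-homo-* (ℤ.+ a / suc b) (ℤ.+ c / suc d) ⟩
    toℚᵘ (ℤ.+ a / suc b) ℚᵘ.* toℚᵘ (ℤ.+ c / suc d)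
      ≃⟨ ℚᵘ.*-cong (toℚᵘ-fromℚᵘ (mkℚᵘ (ℤ.+ a) b)) (toℚᵘ-fromℚᵘ (mkℚᵘ (ℤ.+ c) d)) ⟩
    mkℚᵘ (ℤ.+ a) b ℚᵘ.* mkℚᵘ (ℤ.+ c) d
      ≡⟨ cong (λ n → mkℚᵘ n _) (ℤ.pos-* a c) ⟨
    mkℚᵘ (ℤ.+ (a * c)) _
      ≃⟨ toℚᵘ-fromℚᵘ (mkℚᵘ (ℤ.+ (a * c)) _) ⟨
    toℚᵘ (ℤ.+ (a * c) / (suc b * suc d)) ∎)
    where open ℚᵘ.≤-Reasoning

  ratio-≤ : ∀ m L k l .{{_ : NonZero L}} → m * k ≤ 8 * L * l →
            (ℤ.+ 1 / 8) ℚ.* (ℤ.+ m / L) ℚ.* fromℕ k ℚ.≤ fromℕ l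
  ratio-≤ m L@(suc _) k l mk≤8Ll = begin
    (ℤ.+ 1 / 8) ℚ.* (ℤ.+ m / L) ℚ.* fromℕ k  ≡⟨ cong (ℚ._* fromℕ k) (*-fraction 1 8 m L) ⟩
    (ℤ.+ (1 * m) / (8 * L)) ℚ.* fromℕ k      ≡⟨ *-fraction (1 * m) (8 * L) k 1 ⟩
    ℤ.+ (1 * m * k) / (8 * L * 1)           ≤⟨ ≤-fraction (1 * m * k) (8 * L * 1) l 1 bound ⟩
    fromℕ l                                  ∎
    where
    open ℚ.≤-Reasoning
    bound : 1 * m * k * 1 ≤ l * (8 * L * 1)
    bound = subst₂ _≤_
      (solve 2 (λ m k → m :* k := con 1 :* m :* k :* con 1) refl m k)
      (solve 2 (λ L l → con 8 :* L :* l := l :* (con 8 :* L :* con 1)) refl L l)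
      mk≤8Ll
      where open +-*-Solver

  double-≤ : ∀ m n → m ≤ 2 * n → fromℕ m ℚ.≤ (ℤ.+ 2 / 1) ℚ.* fromℕ n
  double-≤ m n m≤2n = begin
    fromℕ m                 ≤⟨ ≤-fraction m 1 (2 * n) 1 (ℕ.*-monoˡ-≤ 1 m≤2n) ⟩
    fromℕ (2 * n)           ≡⟨ *-fraction 2 1 n 1 ⟨
    (ℤ.+ 2 / 1) ℚ.* fromℕ n ∎
    where open ℚ.≤-Reasoning

open import Data.Integer.Base using (+_)
open import Data.List.Base using (length)
open import Data.Nat.Base using (ℕ; suc; _^_; NonTrivial) renaming (_≤_ to _≤ℕ_)
open import Data.Nat.Logarithm using (⌊log₂_⌋)
import Data.Nat.Properties as ℕ
open import Data.Product.Base using (_×_; _,_; Σ-syntax; ∃-syntax)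
open import Data.Rational.Base as ℚ using (ℚ; 0ℚ; _<_; _≤_; _*_)
import Data.Rational.Properties as ℚ
open import Relation.Binary.PropositionalEquality using (refl)
open DyadicFlows

theorem1 : Σ[ c ∈ ℚ ] Σ[ C ∈ ℚ ] (0ℚ < c) × (0ℚ < C) ×
    (Σ[ I ∈ (ℕ → Instance) ]
    (∀ M → ∃[ i ] (M ≤ℕ Instance.∣E∣ (I i))) ×
    (∀ i → let open Instance (I i) in
    (fromℕ ∣E∣ ≤ C * fromℕ ∣V∣) ×
    (Σ[ nt ∈ NonTrivial ∣E∣ ]
    (∀ k D → IsMFD X k → GreedyWeight X D →
    c * (∣E∣ /log) {{nt}} * fromℕ k ≤ fromℕ (length D)))))
theorem1 =
  -- The first constant comes from `ratio-bound`; the second works because there are three edges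
  -- fewer than twice the number of vertices.
  + 1 ℚ./ 8 , + 2 ℚ./ 1 , ℚ.positive⁻¹ (+ 1 ℚ./ 8) , ℚ.positive⁻¹ (+ 2 ℚ./ 1) ,
  -- Starting at depth 1 provides the link that `greedy-length` asks for, and at least 5 edges, so
  -- that the logarithm is positive.
  (λ i → Family.inst (suc i)) ,
  (λ M → M , ℕ.≤-trans (ℕ.n≤1+n M) (n≤size (suc M))) ,
  λ i → let open Family (suc i) in
    double-≤ (size (suc i)) (2 ^ suc (suc i)) (size-upper (suc i)) , _ ,
    λ k D (_ , minimal) run →
      ratio-≤ (size (suc i)) ⌊log₂ size (suc i) ⌋ k (length D) {{⌊log₂⌋-nonZero (size (suc i))}}
        (ratio-bound {suc i}
          (ℕ.≤-trans (minimal decomposition X-decomposition) (ℕ.≤-reflexive length-decomposition))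
          (log-size i)
          (greedy-length {index {suc i} link} refl run))
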